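{- Let $G$ be a finite abstract simplicial complex. Then $$\sum_{x \in G} w(x)\, w(U(x)) = w(G).$$
   Context: A finite abstract simplicial complex $G$ is a finite set of non-empty finite sets such that every non-empty subset of an element of $G$ is again in $G$. For $x \in G$, $\dim(x)=|x|-1$ and $w(x)=(-1)^{\dim(x)}$. For a subset $A\subset G$, $w(A)=\sum_{x\in A} w(x)$ (the Euler characteristic of $A$), and in particular $w(G)=\sum_{x\in G}w(x)$. The star of $x\in G$ is $U(x)=\{y \in G : x \subset y\}$. -}

module Defs where

open import Data.Nat.Base using (ℕ; _∸_)
open import Data.Integer.Base using (ℤ; 0ℤ; -1ℤ; _+_; _^_)
open import Data.Fin.Subset using (Subset; Nonempty; _⊆_; ∣_∣)
open import Data.Fin.Subset.Properties using (_⊆?_)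
open import Data.List.Base using (List; foldr; map; filter)
open import Data.List.Membership.Propositional using (_∈_)
open import Data.List.Relation.Unary.Unique.Propositional using (Unique)

-- All simplices of a finite complex live in one finite vertex set, here Fin n
-- with n arbitrary; not every element of Fin n need occur in a simplex.
-- On Subset n propositional equality is equality of sets, so a
-- duplicate-free list is a finite set of finite sets.
record SimplicialComplex (n : ℕ) : Set where
  field
    simplices : List (Subset n)
    unique    : Unique simplices
    nonempty  : ∀ {x} → x ∈ simplices → Nonempty x
    closed    : ∀ {x y} → x ∈ simplices → Nonempty y → y ⊆ x → y ∈ simplices

open SimplicialComplex public

-- The truncated subtraction is exact on simplices, which are nonempty.
dim : ∀ {n} → Subset n → ℕ
dim x = ∣ x ∣ ∸ 1

w : ∀ {n} → Subset n → ℤ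
w x = -1ℤ ^ dim x

-- Agrees with the sum over a finite set when the list is duplicate-free.
∑ : ∀ {n} → List (Subset n) → (Subset n → ℤ) → ℤ
∑ A f = foldr _+_ 0ℤ (map f A)

-- The extension of w to sets of simplices (the Euler characteristic).
W : ∀ {n} → List (Subset n) → ℤ
W A = ∑ A w

U : ∀ {n} → SimplicialComplex n → Subset n → List (Subset n)
U G x = filter (x ⊆?_) (simplices G)

{-# OPTIONS --safe #-}

-- Exchanging the order of summation turns the left side into the sum over y ∈ G
-- of w(y) · Σ { w(x) : x ∈ G, x ⊆ y }.  Since G is closed under nonempty
-- subsets, the inner sum runs over all nonempty subsets of y, so it is the Euler
-- characteristic of a full simplex, which is 1.
module Submission where

open import Defs
open import Algebra.Properties.CommutativeSemigroup using (interchange; x∙yz≈z∙yx)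
open import Data.Bool.Base using (if_then_else_)
open import Data.Fin.Base using (zero; suc)
open import Data.Fin.Subset using (Subset; Nonempty; _⊆_; ⊥; inside; outside)
open import Data.Fin.Subset.Properties using (_⊆?_; nonempty?; Empty-unique; ⊥⊆; ∣⊥∣≡0; ∉⊥; out⊆; in⊆in; drop-∷-⊆)
open import Data.Integer.Base using (ℤ; 0ℤ; 1ℤ; -1ℤ; _+_; _*_; _^_)
open import Data.Integer.Properties using (+-identityˡ; +-assoc; +-0-isCommutativeMonoid; +-commutativeSemigroup; *-commutativeSemigroup; *-identityˡ; *-identityʳ; *-zeroʳ; *-distribˡ-+)
open import Data.Integer.Tactic.RingSolver using (solve-∀)
open import Data.List.Base using (List; []; _∷_; _++_; map; filter; foldr)
open import Data.List.Membership.Propositional using (_∈_)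
open import Data.List.Membership.Propositional.Properties using (∈-map⁺; ∈-map⁻; ∈-++⁺ˡ; ∈-++⁺ʳ; ∈-++⁻; ∈-filter⁺; ∈-filter⁻)
open import Data.List.Membership.Propositional.Properties.WithK using (unique∧set⇒bag)
open import Data.List.Properties using (map-∘; map-cong-local)
open import Data.List.Relation.Binary.BagAndSetEquality using (∼bag⇒↭)
open import Data.List.Relation.Binary.Disjoint.Propositional using (Disjoint)
open import Data.List.Relation.Binary.Permutation.Propositional using (_↭_; ↭⇒↭ₛ)
import Data.List.Relation.Binary.Permutation.Propositional.Properties as ↭
import Data.List.Relation.Binary.Permutation.Setoid.Properties as ↭ₛ
import Data.List.Relation.Unary.All as All
open import Data.List.Relation.Unary.AllPairs using ([]; _∷_)
open import Data.List.Relation.Unary.Any using (here; there)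
open import Data.List.Relation.Unary.Unique.Propositional using (Unique)
import Data.List.Relation.Unary.Unique.Propositional.Properties as Unique
open import Data.Nat.Base using (ℕ; suc)
open import Data.Product.Base using (_×_; _,_; proj₁; proj₂)
open import Data.Sum.Base using (inj₁; inj₂)
open import Data.Vec.Base using ([]; _∷_; here; there)
open import Data.Vec.Properties using (∷-injectiveʳ)
open import Function.Base using (_∘_; _$_)
open import Function.Bundles using (mk⇔)
open import Relation.Binary.PropositionalEquality using (_≡_; _≢_; refl; sym; trans; cong; cong₂; setoid; module ≡-Reasoning)
open import Relation.Nullary using (Dec; yes; no; does)
open import Relation.Unary using (Pred; Decidable)

open ≡-Reasoning

private
  variable
    m n : ℕ
    x y : Subset n

-- Equality is asked only of members of `A`: the later uses depend on membership, which supplies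
-- nonemptiness of a face or closure of the complex.
∑-cong : (A : List (Subset n)) {f g : Subset n → ℤ} →
  (∀ {x} → x ∈ A → f x ≡ g x) → ∑ A f ≡ ∑ A g
∑-cong A f≡g = cong (foldr _+_ 0ℤ) (map-cong-local (All.tabulate f≡g))

∑-map : (h : Subset m → Subset n) (A : List (Subset m)) (f : Subset n → ℤ) →
  ∑ (map h A) f ≡ ∑ A (f ∘ h)
∑-map h A f = cong (foldr _+_ 0ℤ) (sym (map-∘ A))

∑-++ : (A B : List (Subset n)) (f : Subset n → ℤ) → ∑ (A ++ B) f ≡ ∑ A f + ∑ B f
∑-++ []      B f = sym (+-identityˡ (∑ B f))
∑-++ (x ∷ A) B f = trans (cong (f x +_) (∑-++ A B f)) (sym (+-assoc (f x) (∑ A f) (∑ B f)))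

∑-↭ : {A B : List (Subset n)} (f : Subset n → ℤ) → A ↭ B → ∑ A f ≡ ∑ B f
∑-↭ f A↭B = ↭ₛ.foldr-commMonoid (setoid ℤ) +-0-isCommutativeMonoid (↭⇒↭ₛ (↭.map⁺ f A↭B))

∑-zero : (A : List (Subset n)) → ∑ A (λ _ → 0ℤ) ≡ 0ℤ
∑-zero []      = refl
∑-zero (x ∷ A) = trans (+-identityˡ _) (∑-zero A)

∑-distrib-+ : (A : List (Subset n)) (f g : Subset n → ℤ) →
  ∑ A (λ x → f x + g x) ≡ ∑ A f + ∑ A g
∑-distrib-+ []      f g = refl
∑-distrib-+ (x ∷ A) f g = trans
  (cong ((f x + g x) +_) (∑-distrib-+ A f g))
  (interchange +-commutativeSemigroup (f x) (g x) (∑ A f) (∑ A g))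

*-distribˡ-∑ : (c : ℤ) (A : List (Subset n)) (f : Subset n → ℤ) →
  c * ∑ A f ≡ ∑ A (λ x → c * f x)
*-distribˡ-∑ c []      f = *-zeroʳ c
*-distribˡ-∑ c (x ∷ A) f = trans
  (*-distribˡ-+ c (f x) (∑ A f)) (cong (c * f x +_) (*-distribˡ-∑ c A f))

∑-swap : (A : List (Subset m)) (B : List (Subset n)) (f : Subset m → Subset n → ℤ) →
  ∑ A (λ x → ∑ B (f x)) ≡ ∑ B (λ y → ∑ A (λ x → f x y))
∑-swap []      B f = sym (∑-zero B)
∑-swap (x ∷ A) B f = trans
  (cong (∑ B (f x) +_) (∑-swap A B f)) (sym (∑-distrib-+ B (f x) (λ y → ∑ A (λ x → f x y))))

-- The Iverson bracket. As a factor it replaces filtering, so that the range of an inner sum no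
-- longer depends on the outer variable.
𝟙 : ∀ {p} {P : Set p} → Dec P → ℤ
𝟙 P? = if does P? then 1ℤ else 0ℤ

∑-filter : ∀ {p} {P : Pred (Subset n) p} (P? : Decidable P) A (f : Subset n → ℤ) →
  ∑ (filter P? A) f ≡ ∑ A (λ x → 𝟙 (P? x) * f x)
∑-filter P? []      f = refl
∑-filter P? (x ∷ A) f with P? x
... | yes _ = cong₂ _+_ (sym (*-identityˡ (f x))) (∑-filter P? A f)
... | no  _ = trans (∑-filter P? A f) (sym (+-identityˡ _))

-- Both sides expand to the double sum of `f x * g y` over the pairs with `x ⊆ y`, grouped once by
-- the smaller set and once by the larger.
∑-exchange-⊆ : (A B : List (Subset n)) (f g : Subset n → ℤ) →
  ∑ A (λ x → f x * ∑ (filter (x ⊆?_) B) g) ≡ ∑ B (λ y → g y * ∑ (filter (_⊆? y) A) f)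
∑-exchange-⊆ A B f g = begin
  ∑ A (λ x → f x * ∑ (filter (x ⊆?_) B) g)
    ≡⟨ ∑-cong A (λ {x} _ → expand (f x) (x ⊆?_) B g) ⟩
  ∑ A (λ x → ∑ B (λ y → f x * (𝟙 (x ⊆? y) * g y)))
    ≡⟨ ∑-swap A B _ ⟩
  ∑ B (λ y → ∑ A (λ x → f x * (𝟙 (x ⊆? y) * g y)))
    ≡⟨ ∑-cong B (λ {y} _ → ∑-cong A (λ {x} _ →
         x∙yz≈z∙yx *-commutativeSemigroup (f x) (𝟙 (x ⊆? y)) (g y))) ⟩
  ∑ B (λ y → ∑ A (λ x → g y * (𝟙 (x ⊆? y) * f x)))
    ≡⟨ ∑-cong B (λ {y} _ → expand (g y) (_⊆? y) A f) ⟨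
  ∑ B (λ y → g y * ∑ (filter (_⊆? y) A) f) ∎
  where
  expand : ∀ {p} {P : Pred (Subset n) p} c (P? : Decidable P) C (h : Subset n → ℤ) →
    c * ∑ (filter P? C) h ≡ ∑ C (λ z → c * (𝟙 (P? z) * h z))
  expand c P? C h = trans (cong (c *_) (∑-filter P? C h)) (*-distribˡ-∑ c C _)

-- The nonempty subsets of `y`, split by whether they contain the first vertex. `⊥` is added in the
-- second half because that vertex may stand alone, although the empty set itself is no face.
faces : Subset n → List (Subset n)
faces []            = []
faces (outside ∷ y) = map (outside ∷_) (faces y)
faces (inside  ∷ y) = map (outside ∷_) (faces y) ++ map (inside ∷_) (⊥ ∷ faces y)

∈-faces⁻ : (y : Subset n) → x ∈ faces y → Nonempty x × x ⊆ y
∈-faces⁻ (outside ∷ y) x∈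
  with x′ , x′∈ , refl ← ∈-map⁻ (outside ∷_) x∈
  with (i , i∈x′) , x′⊆y ← ∈-faces⁻ y x′∈ = (suc i , there i∈x′) , out⊆ x′⊆y
∈-faces⁻ (inside ∷ y) x∈ with ∈-++⁻ (map (outside ∷_) (faces y)) x∈
... | inj₂ (here refl) = (zero , here) , in⊆in ⊥⊆
... | inj₁ x∈ˡ
  with x′ , x′∈ , refl ← ∈-map⁻ (outside ∷_) x∈ˡ
  with (i , i∈x′) , x′⊆y ← ∈-faces⁻ y x′∈ = (suc i , there i∈x′) , out⊆ x′⊆y
... | inj₂ (there x∈ʳ)
  with x′ , x′∈ , refl ← ∈-map⁻ (inside ∷_) x∈ʳ = (zero , here) , in⊆in (proj₂ (∈-faces⁻ y x′∈))

∈-faces⁺ : (x y : Subset n) → Nonempty x → x ⊆ y → x ∈ faces y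
∈-faces⁺ (outside ∷ x) (outside ∷ y) (suc i , there i∈x) x⊆y =
  ∈-map⁺ (outside ∷_) (∈-faces⁺ x y (i , i∈x) (drop-∷-⊆ x⊆y))
∈-faces⁺ (outside ∷ x) (inside  ∷ y) (suc i , there i∈x) x⊆y =
  ∈-++⁺ˡ (∈-map⁺ (outside ∷_) (∈-faces⁺ x y (i , i∈x) (drop-∷-⊆ x⊆y)))
∈-faces⁺ (inside  ∷ x) (outside ∷ y) _ x⊆y with () ← x⊆y here
-- Dropping the first vertex may leave nothing; the set is then the lone vertex, listed at the head
-- of the second half.
∈-faces⁺ (inside  ∷ x) (inside  ∷ y) _ x⊆y with nonempty? x
... | yes x≢∅ = ∈-++⁺ʳ (map (outside ∷_) (faces y))
                  (there (∈-map⁺ (inside ∷_) (∈-faces⁺ x y x≢∅ (drop-∷-⊆ x⊆y))))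
... | no  x≡∅ = ∈-++⁺ʳ (map (outside ∷_) (faces y)) (here (cong (inside ∷_) (Empty-unique x≡∅)))

-- The two halves differ in the first vertex, and the added `⊥` is new because every face is
-- nonempty.
faces-unique : (y : Subset n) → Unique (faces y)
faces-unique []            = []
faces-unique (outside ∷ y) = Unique.map⁺ ∷-injectiveʳ (faces-unique y)
faces-unique (inside  ∷ y) = Unique.++⁺
  (Unique.map⁺ ∷-injectiveʳ (faces-unique y))
  (Unique.map⁺ ∷-injectiveʳ (All.tabulate ⊥≢face ∷ faces-unique y))
  disjoint
  where
  ⊥≢face : ∀ {x} → x ∈ faces y → ⊥ ≢ x
  ⊥≢face x∈ refl = ∉⊥ (proj₂ (proj₁ (∈-faces⁻ y x∈)))

  disjoint : Disjoint (map (outside ∷_) (faces y)) (map (inside ∷_) (⊥ ∷ faces y))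
  disjoint (x∈ˡ , x∈ʳ)
    with _ , _ , refl ← ∈-map⁻ (outside ∷_) x∈ˡ
    with _ , _ , () ← ∈-map⁻ (inside ∷_) x∈ʳ

-- An extra vertex raises the dimension by one. This fails for the empty set, where truncated
-- subtraction makes both weights 1. The recursion runs to the first vertex of `x`, where the
-- subtraction computes.
w-inside : (x : Subset n) → Nonempty x → w (inside ∷ x) ≡ -1ℤ * w x
w-inside (inside  ∷ x) _                   = refl
w-inside (outside ∷ x) (suc i , there i∈x) = w-inside x (i , i∈x)

W-faces : (y : Subset n) → Nonempty y → W (faces y) ≡ 1ℤ
W-faces (outside ∷ y) (suc i , there i∈y) =
  trans (∑-map (outside ∷_) (faces y) w) (W-faces y (i , i∈y))
-- Adding the new vertex pairs each face of y with one of opposite sign; only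
-- the new vertex itself, the partner of the empty set, survives.
W-faces {suc n} (inside ∷ y) _ = begin
  W (map (outside ∷_) (faces y) ++ map (inside ∷_) (⊥ ∷ faces y))
    ≡⟨ ∑-++ (map (outside ∷_) (faces y)) _ w ⟩
  W (map (outside ∷_) (faces y)) + (w (inside ∷ ⊥ {n}) + W (map (inside ∷_) (faces y)))
    ≡⟨ cong₂ _+_ (∑-map (outside ∷_) (faces y) w)
         (cong₂ _+_ (cong (-1ℤ ^_) (∣⊥∣≡0 n)) (∑-map (inside ∷_) (faces y) w)) ⟩
  W (faces y) + (1ℤ + ∑ (faces y) (λ x → w (inside ∷ x)))
    ≡⟨ cong (λ s → W (faces y) + (1ℤ + s))
         (∑-cong (faces y) (λ {x} x∈ → w-inside x (proj₁ (∈-faces⁻ y x∈)))) ⟩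
  W (faces y) + (1ℤ + ∑ (faces y) (λ x → -1ℤ * w x))
    ≡⟨ cong (λ s → W (faces y) + (1ℤ + s)) (*-distribˡ-∑ -1ℤ (faces y) w) ⟨
  W (faces y) + (1ℤ + -1ℤ * W (faces y))
    -- `W (faces y)` cancels whatever its value, so this also covers an empty `y`, where that sum is
    -- 0 and not 1.
    ≡⟨ cancel (W (faces y)) ⟩
  1ℤ ∎
  where
  cancel : ∀ s → s + (1ℤ + -1ℤ * s) ≡ 1ℤ
  cancel = solve-∀

-- Closure puts every nonempty subset of `y` into `G`, and simplices are nonempty, so both lists
-- have the same members. Being duplicate-free, they then agree up to order, which is all a sum can
-- see.
subsimplices↭faces : (G : SimplicialComplex n) → y ∈ simplices G →
  filter (_⊆? y) (simplices G) ↭ faces y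
subsimplices↭faces {y = y} G y∈G = ∼bag⇒↭ $ unique∧set⇒bag
  (Unique.filter⁺ (_⊆? y) (unique G)) (faces-unique y) (mk⇔ to from)
  where
  to : ∀ {x} → x ∈ filter (_⊆? y) (simplices G) → x ∈ faces y
  to {x} x∈ with x∈G , x⊆y ← ∈-filter⁻ (_⊆? y) x∈ = ∈-faces⁺ x y (nonempty G x∈G) x⊆y

  from : ∀ {x} → x ∈ faces y → x ∈ filter (_⊆? y) (simplices G)
  from x∈ with x≢∅ , x⊆y ← ∈-faces⁻ y x∈ = ∈-filter⁺ (_⊆? y) (closed G y∈G x≢∅ x⊆y) x⊆y

mainTheorem1 : ∀ (n : ℕ) (G : SimplicialComplex n) →
    ∑ (simplices G) (λ x → w x * W (U G x)) ≡ W (simplices G)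
mainTheorem1 n G = begin
  ∑ (simplices G) (λ x → w x * W (U G x))
    ≡⟨ ∑-exchange-⊆ (simplices G) (simplices G) w w ⟩
  ∑ (simplices G) (λ y → w y * W (filter (_⊆? y) (simplices G)))
    ≡⟨ ∑-cong (simplices G) (λ {y} y∈G → trans
         (cong (w y *_) (trans (∑-↭ w (subsimplices↭faces G y∈G)) (W-faces y (nonempty G y∈G))))
         (*-identityʳ (w y))) ⟩
  W (simplices G) ∎
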